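{- Let $(S,T,\to,\hat s)$ be a transition system with deterministic transitions and initial state $\hat s$, and let $\mathcal{T}$ be an assignment of a set $\mathcal{T}(s)\subseteq T$ to each $s\in S$ such that D0, D1 and D2 hold at every $s_0\in S$. Then the full state space is AG EF terminating if and only if the reduced state space induced by $\mathcal{T}$ is AG EF terminating. That is, the following are equivalent: (i) from every reachable state, a terminal state is reachable; (ii) from every r-state, there is an r-path to an r-state from which no r-edge starts.
   Context: $S$ is a set of states, $T$ a set of transitions, and $\hat s\in S$ the initial state. We write $s\xrightarrow{t}s'$ if transition $t\in T$ is enabled at $s\in S$ and firing it at $s$ yields $s'$; we write $s\xrightarrow{t}$ if $t$ is enabled at $s$, i.e. if $s\xrightarrow{t}s'$ for some $s'$. Transitions are deterministic: if $s\xrightarrow{t}s_1$ and $s\xrightarrow{t}s_2$ then $s_1=s_2$. The notation extends to finite (possibly empty) sequences: $s\xrightarrow{t_1\cdots t_n}s'$. A state is terminal if no transition is enabled at it. A state $s'$ is reachable from $s$ if $s\xrightarrow{t_1\cdots t_n}s'$ for some finite, possibly empty, sequence; a state is reachable if it is reachable from $\hat s$. The full state space is the directed graph of reachable states and the edges $s\xrightarrow{t}s'$ between them. Stubborn sets (basic strong stubborn set method): each $s\in S$ is assigned a set $\mathcal{T}(s)\subseteq T$ such that for every $s_0\in S$, every $t\in\mathcal{T}(s_0)$ and all $t_1,\dots,t_n\notin\mathcal{T}(s_0)$: D0: if $s_0$ is not terminal, then $\mathcal{T}(s_0)$ contains a transition enabled at $s_0$. D1: if $s_0\xrightarrow{t_1\cdots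 t_n t}s'_n$, then $s_0\xrightarrow{t t_1\cdots t_n}s'_n$. D2: if $s_0\xrightarrow{t}$ and $s_0\xrightarrow{t_1\cdots t_n}s_n$, then $s_n\xrightarrow{t}$. The reduced state space is the smallest directed graph that contains $\hat s$ and such that, for each of its states $s$ and each $t\in\mathcal{T}(s)$ with $s\xrightarrow{t}s'$, it contains the edge $s\xrightarrow{t}s'$ and the state $s'$. Its states, edges and paths are called r-states, r-edges and r-paths. -}

module Defs where

open import Level using (Level; _⊔_; suc)
open import Data.List using (List; []; _∷_; _∷ʳ_)
open import Data.List.Relation.Unary.All using (All)
open import Data.Product using (∃-syntax; _×_)
open import Relation.Binary.PropositionalEquality using (_≡_)
open import Relation.Nullary using (¬_)
open import Relation.Unary using (Pred; _∈_; _∉_)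

record TransitionSystem (a b c : Level) : Set (suc (a ⊔ b ⊔ c)) where
  field
    S             : Set a
    T             : Set b
    ŝ             : S
    _⟶[_]_        : S → T → S → Set c
    deterministic : ∀ {s t s₁ s₂} → s ⟶[ t ] s₁ → s ⟶[ t ] s₂ → s₁ ≡ s₂

data Path {a b c} {S : Set a} {T : Set b} (_⟶[_]_ : S → T → S → Set c) :
          S → List T → S → Set (a ⊔ b ⊔ c) where
  []  : ∀ {s} → Path _⟶[_]_ s [] s
  _∷_ : ∀ {s s′ s″ t ts} → s ⟶[ t ] s′ → Path _⟶[_]_ s′ ts s″ →
        Path _⟶[_]_ s (t ∷ ts) s″

module FullStateSpace {a b c} (M : TransitionSystem a b c) where
  open TransitionSystem M public

  _⟶*[_]_ : S → List T → S → Set (a ⊔ b ⊔ c)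
  s ⟶*[ ts ] s′ = Path _⟶[_]_ s ts s′

  Enabled : S → T → Set (a ⊔ c)
  Enabled s t = ∃[ s′ ] s ⟶[ t ] s′

  Terminal : S → Set (a ⊔ b ⊔ c)
  Terminal s = ∀ t → ¬ Enabled s t

  ReachableFrom : S → S → Set (a ⊔ b ⊔ c)
  ReachableFrom s s′ = ∃[ ts ] s ⟶*[ ts ] s′

  Reachable : S → Set (a ⊔ b ⊔ c)
  Reachable s = ReachableFrom ŝ s

  FullAGEFTerminating : Set (a ⊔ b ⊔ c)
  FullAGEFTerminating =
    ∀ s → Reachable s → ∃[ s′ ] (ReachableFrom s s′ × Terminal s′)

module ReducedStateSpace {a b c d} (M : TransitionSystem a b c)
                         (𝒯 : TransitionSystem.S M → Pred (TransitionSystem.T M) d) where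
  open FullStateSpace M

  D0 : S → Set (a ⊔ b ⊔ c ⊔ d)
  D0 s₀ = ¬ Terminal s₀ → ∃[ t ] (t ∈ 𝒯 s₀ × Enabled s₀ t)

  D1 : S → Set (a ⊔ b ⊔ c ⊔ d)
  D1 s₀ = ∀ t → t ∈ 𝒯 s₀ → ∀ ts → All (_∉ 𝒯 s₀) ts →
          ∀ s′ → s₀ ⟶*[ ts ∷ʳ t ] s′ → s₀ ⟶*[ t ∷ ts ] s′

  D2 : S → Set (a ⊔ b ⊔ c ⊔ d)
  D2 s₀ = ∀ t → t ∈ 𝒯 s₀ → ∀ ts → All (_∉ 𝒯 s₀) ts →
          ∀ s → Enabled s₀ t → s₀ ⟶*[ ts ] s → Enabled s t

  IsStubborn : Set (a ⊔ b ⊔ c ⊔ d)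
  IsStubborn = ∀ s₀ → D0 s₀ × D1 s₀ × D2 s₀

  -- The smallest graph closed under the generating rules: RState is its
  -- vertex set and REdge its edge set.
  data RState : S → Set (a ⊔ b ⊔ c ⊔ d) where
    initial   : RState ŝ
    successor : ∀ {s t s′} → RState s → t ∈ 𝒯 s → s ⟶[ t ] s′ → RState s′

  data REdge : S → T → S → Set (a ⊔ b ⊔ c ⊔ d) where
    edge : ∀ {s t s′} → RState s → t ∈ 𝒯 s → s ⟶[ t ] s′ → REdge s t s′

  RReachableFrom : S → S → Set (a ⊔ b ⊔ c ⊔ d)
  RReachableFrom s s′ = ∃[ ts ] Path REdge s ts s′

  RTerminal : S → Set (a ⊔ b ⊔ c ⊔ d)
  RTerminal s = ¬ (∃[ t ] ∃[ s′ ] REdge s t s′)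

  ReducedAGEFTerminating : Set (a ⊔ b ⊔ c ⊔ d)
  ReducedAGEFTerminating =
    ∀ s → RState s → ∃[ s′ ] (RState s′ × RReachableFrom s s′ × RTerminal s′)

{-# OPTIONS --safe #-}
-- Let r be an r-state and r ⟶*[ ts ] s.  If some transition of ts is in 𝒯 r,
-- D1 moves the first such transition to the front, so s is also reached from
-- an r-successor of r by a path shorter by one.  Otherwise D1 and D2 carry any
-- enabled t ∈ 𝒯 r over ts: s enables t, and the t-successor of s is reached
-- by the same ts from the t-successor of r.
--
-- If s is terminal, then only the first case can occur (or r itself is
-- terminal), so some r-path from r ends in s.  Conversely, for arbitrary s,
-- follow an r-path from r to an r-terminal state with the second case.  In the
-- first case choose a new r-path; as ts gets shorter, this happens finitely
-- often.  The r-terminal state reached in the end is terminal by D0, so ts is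
-- empty there.
module Submission where

open import Defs
open import Axiom.ExcludedMiddle using (ExcludedMiddle)
open import Data.List using (List; []; _∷_; _∷ʳ_; _++_; length)
open import Data.List.Properties using (length-++-sucʳ)
open import Data.List.Relation.Unary.All using (All)
open import Data.List.Relation.Unary.First using (FirstView; _++_∷_; first)
open import Data.List.Relation.Unary.First.Properties using (toView)
open import Data.Nat using (suc)
open import Data.Nat.Properties using (suc-injective)
open import Data.Product using (∃-syntax; _×_; _,_; proj₁; proj₂)
open import Data.Sum using (inj₁; inj₂; swap)
open import Function.Bundles using (_⇔_; mk⇔)
open import Level using (_⊔_)
open import Relation.Binary.PropositionalEquality using (_≡_; refl; sym; trans)
open import Relation.Nullary using (contradiction)
open import Relation.Nullary.Decidable using (toSum)
open import Relation.Unary using (Pred; Decidable; _∈_; _∉_)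

module _ {a b c} {S : Set a} {T : Set b} {_⟶[_]_ : S → T → S → Set c} where

  infixr 5 _++ᵖ_

  _++ᵖ_ : ∀ {s s′ s″ ts us} → Path _⟶[_]_ s ts s′ → Path _⟶[_]_ s′ us s″ →
          Path _⟶[_]_ s (ts ++ us) s″
  []      ++ᵖ q = q
  (e ∷ p) ++ᵖ q = e ∷ (p ++ᵖ q)

  splitᵖ : ∀ ts {us s s″} → Path _⟶[_]_ s (ts ++ us) s″ →
           ∃[ s′ ] (Path _⟶[_]_ s ts s′ × Path _⟶[_]_ s′ us s″)
  splitᵖ []       p       = _ , [] , p
  splitᵖ (_ ∷ ts) (e ∷ p) with _ , p₁ , p₂ ← splitᵖ ts p = _ , e ∷ p₁ , p₂

module StubbornSets {a b c d} (M : TransitionSystem a b c)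
                    (𝒯 : TransitionSystem.S M → Pred (TransitionSystem.T M) d)
                    (stubborn : ReducedStateSpace.IsStubborn M 𝒯)
                    (𝒯? : ∀ s → Decidable (𝒯 s)) where
  open FullStateSpace M
  open ReducedStateSpace M 𝒯

  d0 : ∀ s → D0 s
  d0 s = proj₁ (stubborn s)

  d1 : ∀ s → D1 s
  d1 s = proj₁ (proj₂ (stubborn s))

  d2 : ∀ s → D2 s
  d2 s = proj₂ (proj₂ (stubborn s))

  RState⇒Reachable : ∀ {s} → RState s → Reachable s
  RState⇒Reachable initial = [] , []
  RState⇒Reachable (successor r _ e) with _ , p ← RState⇒Reachable r =
    _ , p ++ᵖ e ∷ []

  Terminal⇒RTerminal : ∀ {s} → Terminal s → RTerminal s
  Terminal⇒RTerminal term (t , s′ , edge _ _ e) = term t (s′ , e)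

  RTerminal⇒Terminal : ∀ {s} → RState s → RTerminal s → Terminal s
  RTerminal⇒Terminal {s} r rterm t enabled
    with u , u∈ , s′ , e ← d0 s (λ term → term t enabled) =
    rterm (u , s′ , edge r u∈ e)

  -- `meets` relates `us` to `ts` by length alone, since the inductions below need only that
  -- measure.
  data PathView (s : S) (ts : List T) (s′ : S) : Set (a ⊔ b ⊔ c ⊔ d) where
    avoids : All (_∉ 𝒯 s) ts → PathView s ts s′
    meets  : ∀ {t s₁ us} → t ∈ 𝒯 s → s ⟶[ t ] s₁ → s₁ ⟶*[ us ] s′ →
             length ts ≡ suc (length us) → PathView s ts s′

  meets-first : ∀ {s ts s′} → FirstView (_∉ 𝒯 s) (𝒯 s) ts → s ⟶*[ ts ] s′ →
                PathView s ts s′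
  meets-first {s} (_++_∷_ {ts} {t} avoid t∈ us) p
    with _ , p₁ , e ∷ p₂ ← splitᵖ ts p
    -- D1 needs `t` to come last, so it is applied to the path cut right after `t`; the rest `p₂` is
    -- appended again.
    with f ∷ q ← d1 s t t∈ ts avoid _ (p₁ ++ᵖ e ∷ []) =
    meets t∈ f (q ++ᵖ p₂) (length-++-sucʳ ts t us)

  pathView : ∀ {s ts s′} → s ⟶*[ ts ] s′ → PathView s ts s′
  pathView {s} {ts} p with first (λ t → swap (toSum (𝒯? s t))) ts
  ... | inj₁ found = meets-first (toView found) p
  ... | inj₂ avoid = avoids avoid

  shift : ∀ {r r₁ s t ts} → t ∈ 𝒯 r → All (_∉ 𝒯 r) ts → r ⟶[ t ] r₁ →
          r ⟶*[ ts ] s → ∃[ s₁ ] (s ⟶[ t ] s₁ × r₁ ⟶*[ ts ] s₁)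
  shift {r} {t = t} {ts} t∈ avoid e p
    with s₁ , f ← d2 r t t∈ ts avoid _ (_ , e) p
    with e′ ∷ q ← d1 r t t∈ ts avoid s₁ (p ++ᵖ f ∷ [])
    -- D1 yields some `t`-successor of `r`; determinism makes it `r₁`.
    with refl ← deterministic e e′ = s₁ , f , q

  rreach-terminal : ∀ n {r s ts} → length ts ≡ n → RState r → r ⟶*[ ts ] s →
                    Terminal s → RState s × RReachableFrom r s
  rreach-terminal _ _ r [] _ = r , [] , []
  rreach-terminal (suc n) len r p@(e ∷ _) term with pathView p
  ... | meets t∈ f q eq
    with r′ , _ , path ← rreach-terminal n (suc-injective (trans (sym eq) len))
                           (successor r t∈ f) q term =
    r′ , _ , edge r t∈ f ∷ path
  ... | avoids avoid
    -- The first edge `e` shows that D0 applies; by D2 the transition found stays enabled at the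
    -- terminal `s`.
    with t , t∈ , enabled ← d0 _ (λ term₀ → term₀ _ (_ , e)) =
    contradiction (d2 _ t t∈ _ avoid _ enabled p) (term t)

  full⇒reduced : FullAGEFTerminating → ReducedAGEFTerminating
  full⇒reduced full s r
    with s′ , (_ , p) , term ← full s (RState⇒Reachable r)
    with r′ , path ← rreach-terminal _ refl r p term =
    s′ , r′ , path , Terminal⇒RTerminal term

  module _ (reduced : ReducedAGEFTerminating) where

    -- The termination order is lexicographic: first length ts, then the r-path.
    reach-terminal : ∀ n {r r′ s ts us} → length ts ≡ n → RState r →
                     Path REdge r us r′ → RTerminal r′ → r ⟶*[ ts ] s →
                     ∃[ s′ ] (ReachableFrom s s′ × Terminal s′)
    reach-terminal _ _ r [] rterm [] =
      _ , ([] , []) , RTerminal⇒Terminal r rterm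
    reach-terminal _ _ r [] rterm (e ∷ _) =
      contradiction (_ , e) (RTerminal⇒Terminal r rterm _)
    reach-terminal n len r (edge _ t∈ e ∷ path) rterm p with pathView p
    ... | avoids avoid
      with _ , f , q ← shift t∈ avoid e p
      with s′ , (_ , p′) , term ←
             reach-terminal n len (successor r t∈ e) path rterm q =
      s′ , (_ , f ∷ p′) , term
    reach-terminal (suc n) len r (edge _ _ _ ∷ _) _ p | meets u∈ f q eq
      with r₁ ← successor r u∈ f
      with _ , _ , (_ , path) , rterm ← reduced _ r₁ =
      reach-terminal n (suc-injective (trans (sym eq) len)) r₁ path rterm q
    reach-terminal 0 len _ (edge _ _ _ ∷ _) _ _ | meets _ _ _ eq
      with () ← trans (sym eq) len

    reduced⇒full : FullAGEFTerminating
    reduced⇒full s (_ , p)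
      with _ , _ , (_ , path) , rterm ← reduced ŝ initial =
      reach-terminal _ refl initial path rterm p

theorem3 : ∀ {a b c d} → ExcludedMiddle d →
    (M : TransitionSystem a b c)
    (𝒯 : TransitionSystem.S M → Pred (TransitionSystem.T M) d) →
    ReducedStateSpace.IsStubborn M 𝒯 →
    FullStateSpace.FullAGEFTerminating M ⇔ ReducedStateSpace.ReducedAGEFTerminating M 𝒯
theorem3 em M 𝒯 stubborn = mk⇔ full⇒reduced reduced⇒full
  -- Excluded middle decides membership in `𝒯 s`, so that a path can be searched for its first such
  -- transition.
  where open StubbornSets M 𝒯 stubborn (λ _ _ → em)
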